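{- The following equalities of classes hold: $$\begin{aligned}\mathbb{K}_{\mathbf{mbCci}}&=\{\mathcal{B}\in\mathbb{K}_{\mathbf{mbCciw}}:\mathcal{M}(\mathcal{B})\text{ validates }(\mathbf{ci})\}\\&=\{\mathcal{B}\in\mathbb{K}_{\mathbf{mbC}}:\mathcal{M}(\mathcal{B})\text{ validates }(\mathbf{ci})\}\\&=\{\mathcal{B}\in\mathbb{K}_{\mathbf{CPL}^+_{\mathbf e}}:\mathcal{M}(\mathcal{B})\text{ validates }(\mathbf{Ax10}),(\mathbf{bc1})\text{ and }(\mathbf{ci})\}\end{aligned}$$ and $$\begin{aligned}\mathbb{K}_{\mathbf{Ci}}&=\{\mathcal{B}\in\mathbb{K}_{\mathbf{mbCci}}:\mathcal{M}(\mathcal{B})\text{ validates }(\mathbf{cf})\}\\&=\{\mathcal{B}\in\mathbb{K}_{\mathbf{mbCciw}}:\mathcal{M}(\mathcal{B})\text{ validates }(\mathbf{ci})\text{ and }(\mathbf{cf})\}\\&=\{\mathcal{B}\in\mathbb{K}_{\mathbf{mbC}}:\mathcal{M}(\mathcal{B})\text{ validates }(\mathbf{ci})\text{ and }(\mathbf{cf})\}\\&=\{\mathcal{B}\in\mathbb{K}_{\mathbf{CPL}^+_{\mathbf e}}:\mathcal{M}(\mathcal{B})\text{ validates }(\mathbf{Ax10}),(\mathbf{bc1}),(\mathbf{ci})\text{ and }(\mathbf{cf})\}.\end{aligned}$$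
   Context: Let $\Sigma=\{\wedge,\vee,\to,\neg,\circ\}$ ($\neg,\circ$ unary, the others binary); $For(\Sigma)$ is the set of formulas over $\Sigma$ generated by a denumerable set of propositional variables. A multialgebra over $\Sigma$ is a nonempty set with operations whose values are nonempty subsets. For a Boolean algebra $\mathcal{A}$ with domain $A$ (the one-element Boolean algebra is allowed) and $z\in A^3$ write $z=(z_1,z_2,z_3)$; $\sim$ is Boolean complement. A swap structure for $\mathbf{CPL}^+_{\mathbf e}$ over $\mathcal{A}$ is a multialgebra $\mathcal{B}$ over $\Sigma$ with domain $|\mathcal{B}|=B\subseteq A^3$ such that $0\in\{z_1:z\in B\}$ and for all $z,w\in B$: $\emptyset\ne z\#w\subseteq\{u\in B: u_1=z_1\# w_1\}$ for $\#\in\{\wedge,\vee,\to\}$; $\emptyset\neq\neg z\subseteq\{u\in B:u_1=z_2\}$; $\emptyset\ne\circ z\subseteq\{u\in B:u_1=z_3\}$. $\mathbb{K}_{\mathbf{CPL}^+_{\mathbf e}}$ is the class of all of these, over arbitrary Boolean algebras. $\mathbb{K}_{\mathbf{mbC}}$ consists of those with $B\subseteq\{z\in A^3: z_1\vee z_2=1,\ z_1\wedge z_2\wedge z_3=0\}$; $\mathbb{K}_{\mathbf{mbCciw}}$ of those with $B\subseteq\{z\in A^3: z_1\vee z_2=1,\ z_3={\sim}(z_1\wedge z_2)\}$; $\mathbb{K}_{\mathbf{mbCci}}$ of those $\mathcal{B}\in\mathbb{K}_{\mathbf{mbCciw}}$ with $\circ z=\{({\sim}(z_1\wedge z_2),z_1\wedge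 z_2,1)\}$ for all $z\in B$; $\mathbb{K}_{\mathbf{Ci}}$ of those $\mathcal{B}\in\mathbb{K}_{\mathbf{mbCci}}$ with $\neg z\subseteq\{u\in B:u_1=z_2\text{ and }u_2\le z_1\}$ for all $z\in B$. $\mathcal{M}(\mathcal{B})=(\mathcal{B},D_{\mathcal{B}})$ is the Nmatrix with designated set $D_{\mathcal{B}}=\{z\in B: z_1=1\}$. A valuation over $\mathcal{M}(\mathcal{B})$ is $v:For(\Sigma)\to B$ with $v(\alpha\#\beta)\in v(\alpha)\#v(\beta)$, $v(\neg\alpha)\in\neg v(\alpha)$, $v(\circ\alpha)\in\circ v(\alpha)$. $\mathcal{M}(\mathcal{B})$ validates an axiom schema if $v(\gamma)\in D_{\mathcal{B}}$ for every instance $\gamma$ and every valuation $v$. The schemas are: $(\mathbf{Ax10})$ $\alpha\vee\neg\alpha$; $(\mathbf{bc1})$ $\circ\alpha\to(\alpha\to(\neg\alpha\to\beta))$; $(\mathbf{ci})$ $\neg{\circ}\alpha\to(\alpha\wedge\neg\alpha)$; $(\mathbf{cf})$ $\neg\neg\alpha\to\alpha$. -}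

module Defs where

open import Data.Nat.Base using (ℕ)
open import Data.Product.Base using (Σ; ∃-syntax; _×_; _,_; proj₁)
open import Data.Product.Relation.Binary.Pointwise.NonDependent using (_×ₛ_)
open import Level using (Level; suc; _⊔_; 0ℓ)
open import Relation.Binary.Bundles using (Setoid)
open import Relation.Binary.Definitions using (_Respects_)
open import Relation.Binary.Lattice.Bundles using (BooleanAlgebra)
open import Relation.Unary using (Pred; _∈_; _⊆_; _≐_; _∩_; Satisfiable)
import Relation.Binary.Construct.On as On

data Binary : Set where
  and or imp : Binary

data Unary : Set where
  neg circ : Unary

data Formula : Set where
  var : ℕ → Formula
  bin : Binary → Formula → Formula → Formula
  un  : Unary → Formula → Formula

infixr 7 _∧ᶠ_
infixr 6 _∨ᶠ_
infixr 5 _→ᶠ_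
infix  8 ¬ᶠ_ ∘ᶠ_

pattern _∧ᶠ_ α β = bin and α β
pattern _∨ᶠ_ α β = bin or α β
pattern _→ᶠ_ α β = bin imp α β
pattern ¬ᶠ_ α    = un neg α
pattern ∘ᶠ_ α    = un circ α

-- A schema is the set of its instances.
Schema : Set₁
Schema = Pred Formula 0ℓ

data Ax10 : Schema where
  inst : ∀ α → Ax10 (α ∨ᶠ ¬ᶠ α)

data bc1 : Schema where
  inst : ∀ α β → bc1 (∘ᶠ α →ᶠ (α →ᶠ (¬ᶠ α →ᶠ β)))

data ci : Schema where
  inst : ∀ α → ci (¬ᶠ ∘ᶠ α →ᶠ (α ∧ᶠ ¬ᶠ α))

data cf : Schema where
  inst : ∀ α → cf (¬ᶠ ¬ᶠ α →ᶠ α)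

-- Sets are setoids, so subsets and multioperations are required to be
-- invariant under the equality; a nonempty subset comes with an element.
record Multialgebra {s ℓ} (S : Setoid s ℓ) (m : Level) : Set (s ⊔ ℓ ⊔ suc m) where
  open Setoid S using (Carrier; _≈_)
  field
    inhabitant  : Carrier
    op₁         : Unary → Carrier → Pred Carrier m
    op₂         : Binary → Carrier → Carrier → Pred Carrier m
    op₁-nonempty : ∀ ⋆ z → Satisfiable (op₁ ⋆ z)
    op₂-nonempty : ∀ # z w → Satisfiable (op₂ # z w)
    op₁-resp    : ∀ ⋆ {z z′ u u′} → z ≈ z′ → u ≈ u′ →
                  u ∈ op₁ ⋆ z → u′ ∈ op₁ ⋆ z′
    op₂-resp    : ∀ # {z z′ w w′ u u′} → z ≈ z′ → w ≈ w′ → u ≈ u′ →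
                  u ∈ op₂ # z w → u′ ∈ op₂ # z′ w′

record Nmatrix (s ℓ m d : Level) : Set (suc (s ⊔ ℓ ⊔ m ⊔ d)) where
  field
    domain          : Setoid s ℓ
    multialgebra    : Multialgebra domain m
  open Setoid domain public using (Carrier; _≈_)
  open Multialgebra multialgebra public
  field
    Designated      : Pred Carrier d
    designated-resp : Designated Respects _≈_

record Valuation {s ℓ m d} (M : Nmatrix s ℓ m d) : Set (s ⊔ m) where
  open Nmatrix M
  field
    value : Formula → Carrier
    isHom₁ : ∀ ⋆ α → value (un ⋆ α) ∈ op₁ ⋆ (value α)
    isHom₂ : ∀ # α β → value (bin # α β) ∈ op₂ # (value α) (value β)

Validates : ∀ {s ℓ m d} → Nmatrix s ℓ m d → Schema → Set (s ⊔ m ⊔ d)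
Validates M ax = ∀ {γ} → γ ∈ ax → (v : Valuation M) → Valuation.value v γ ∈ Designated
  where open Nmatrix M

module Triples {a ℓ₁ ℓ₂} (𝒜 : BooleanAlgebra a ℓ₁ ℓ₂) where
  open BooleanAlgebra 𝒜

  A³ : Setoid a ℓ₁
  A³ = setoid ×ₛ (setoid ×ₛ setoid)

  Triple : Set a
  Triple = Setoid.Carrier A³

  open Setoid A³ public using () renaming (_≈_ to _≈³_)

  π₁ π₂ π₃ : Triple → Carrier
  π₁ (z₁ , z₂ , z₃) = z₁
  π₂ (z₁ , z₂ , z₃) = z₂
  π₃ (z₁ , z₂ , z₃) = z₃

  ⟦_⟧ : Binary → Carrier → Carrier → Carrier
  ⟦ and ⟧ = _∧_
  ⟦ or  ⟧ = _∨_
  ⟦ imp ⟧ = _⇨_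

  -- The coordinate of z in which the first coordinate of elements of ¬z (resp. ∘z) is read.
  index : Unary → Triple → Carrier
  index neg  = π₂
  index circ = π₃

-- A multialgebra whose domain is a subset B of A³ for a Boolean algebra A
-- (which may be degenerate).  Elements of B are compared as triples, ignoring
-- the membership proof.
record TripleMultialgebra (a ℓ₁ ℓ₂ b m : Level) : Set (suc (a ⊔ ℓ₁ ⊔ ℓ₂ ⊔ b ⊔ m)) where
  field
    𝒜      : BooleanAlgebra a ℓ₁ ℓ₂
  open Triples 𝒜 public
  field
    B      : Pred Triple b
    B-resp : B Respects _≈³_

  ∣B∣ : Setoid (a ⊔ b) ℓ₁
  ∣B∣ = On.setoid {B = Σ Triple B} A³ proj₁

  field
    multialgebra : Multialgebra ∣B∣ m

  open BooleanAlgebra 𝒜 public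
  open Multialgebra multialgebra public

  Elt : Set (a ⊔ b)
  Elt = Setoid.Carrier ∣B∣

  fst snd thd : Elt → Carrier
  fst z = π₁ (proj₁ z)
  snd z = π₂ (proj₁ z)
  thd z = π₃ (proj₁ z)

𝓜 : ∀ {a ℓ₁ ℓ₂ b m} → TripleMultialgebra a ℓ₁ ℓ₂ b m → Nmatrix (a ⊔ b) ℓ₁ m ℓ₁
𝓜 𝓑 = record
  { domain          = ∣B∣
  ; multialgebra    = multialgebra
  ; Designated      = λ z → fst z ≈ ⊤
  ; designated-resp = λ (z₁≈w₁ , _) z₁≈⊤ → Eq.trans (Eq.sym z₁≈w₁) z₁≈⊤
  }
  where open TripleMultialgebra 𝓑

module Classes (a ℓ₁ ℓ₂ b m : Level) where

  Class : (ℓ : Level) → Set (suc (a ⊔ ℓ₁ ⊔ ℓ₂ ⊔ b ⊔ m ⊔ ℓ))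
  Class ℓ = Pred (TripleMultialgebra a ℓ₁ ℓ₂ b m) ℓ

  record 𝕂-CPL⁺ₑ (𝓑 : TripleMultialgebra a ℓ₁ ℓ₂ b m) : Set (a ⊔ ℓ₁ ⊔ b ⊔ m) where
    open TripleMultialgebra 𝓑
    field
      zero∈π₁ : ∃[ z ] fst z ≈ ⊥
      op₂-fst : ∀ # z w → op₂ # z w ⊆ λ u → fst u ≈ ⟦ # ⟧ (fst z) (fst w)
      op₁-fst : ∀ ⋆ z → op₁ ⋆ z ⊆ λ u → fst u ≈ index ⋆ (proj₁ z)

  𝕂-mbC : Class (a ⊔ ℓ₁ ⊔ b ⊔ m)
  𝕂-mbC = 𝕂-CPL⁺ₑ ∩ λ 𝓑 → let open TripleMultialgebra 𝓑 in
    B ⊆ λ z → (π₁ z ∨ π₂ z ≈ ⊤) × (π₁ z ∧ π₂ z ∧ π₃ z ≈ ⊥)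

  𝕂-mbCciw : Class (a ⊔ ℓ₁ ⊔ b ⊔ m)
  𝕂-mbCciw = 𝕂-CPL⁺ₑ ∩ λ 𝓑 → let open TripleMultialgebra 𝓑 in
    B ⊆ λ z → (π₁ z ∨ π₂ z ≈ ⊤) × (π₃ z ≈ ¬ (π₁ z ∧ π₂ z))

  𝕂-mbCci : Class (a ⊔ ℓ₁ ⊔ b ⊔ m)
  𝕂-mbCci = 𝕂-mbCciw ∩ λ 𝓑 → let open TripleMultialgebra 𝓑 in
    ∀ z → op₁ circ z ≐ λ u → proj₁ u ≈³ (¬ (fst z ∧ snd z) , fst z ∧ snd z , ⊤)

  𝕂-Ci : Class (a ⊔ ℓ₁ ⊔ ℓ₂ ⊔ b ⊔ m)
  𝕂-Ci = 𝕂-mbCci ∩ λ 𝓑 → let open TripleMultialgebra 𝓑 in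
    ∀ z → op₁ neg z ⊆ λ u → (fst u ≈ snd z) × (snd u ≤ fst z)

  Validating : Schema → Class (a ⊔ ℓ₁ ⊔ b ⊔ m)
  Validating ax 𝓑 = Validates (𝓜 𝓑) ax

{-# OPTIONS --safe #-}
-- In a swap structure each schema amounts to an inequality between the
-- coordinates of the snapshots z: (Ax10) to z₁ ∨ z₂ = 1, (bc1) to
-- z₁ ∧ z₂ ∧ z₃ = 0, (ci) to u₂ ≤ z₁ ∧ z₂ for u ∈ ∘z, and (cf) to u₂ ≤ z₁ for
-- u ∈ ¬z.  The necessity of these inequalities is read off a valuation which
-- sends a propositional variable p to z and ¬p or ∘p to u.  What remains is
-- Boolean algebra: for u ∈ ∘z we have u₁ = z₃, so u₁ ∨ u₂ = 1 and (ci) make z₃ a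
-- complement of z₁ ∧ z₂; the same fact applied to u then determines u.
module Submission where

open import Defs
open import Data.Nat.Base using (zero; suc)
open import Data.Product.Base using (_×_; _,_; proj₁; proj₂)
open import Function.Bundles using (_⇔_; mk⇔; module Equivalence)
open import Level using (Level)
open import Relation.Binary.Bundles using (Setoid)
open import Relation.Binary.Lattice.Bundles using (BooleanAlgebra)
open import Relation.Unary using (_∈_; _⊆_; _≐_; _∩_; Satisfiable)

open Equivalence using (to; from)

-- Boolean algebra: case distinction and complements.

module BooleanAlgebraProperties {a ℓ₁ ℓ₂ : Level} (𝒜 : BooleanAlgebra a ℓ₁ ℓ₂) where
  open BooleanAlgebra 𝒜
  open import Relation.Binary.Lattice.Properties.MeetSemilattice meetSemilattice public
    using (∧-comm; ∧-assoc; ∧-cong)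
  open import Relation.Binary.Lattice.Properties.JoinSemilattice joinSemilattice public
    using (∨-cong)
  open import Relation.Binary.Lattice.Properties.HeytingAlgebra heytingAlgebra
    using (∧-distribˡ-∨-≤)

  ⊤≤⇒≈⊤ : ∀ {x} → ⊤ ≤ x → x ≈ ⊤
  ⊤≤⇒≈⊤ = antisym (maximum _)

  ≤⊥⇒≈⊥ : ∀ {x} → x ≤ ⊥ → x ≈ ⊥
  ≤⊥⇒≈⊥ x≤⊥ = antisym x≤⊥ (minimum _)

  -- By distributivity `x` lies below `(x ∧ c) ∨ (x ∧ d)`, so an inequality may be checked
  -- separately on the two pieces of a cover of `⊤`.
  ∨-cases : ∀ {x y c d} → c ∨ d ≈ ⊤ → x ∧ c ≤ y → x ∧ d ≤ y → x ≤ y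
  ∨-cases c∨d≈⊤ x∧c≤y x∧d≤y =
    trans (∧-greatest refl (trans (maximum _) (reflexive (Eq.sym c∨d≈⊤))))
          (trans (∧-distribˡ-∨-≤ _ _ _) (∨-least x∧c≤y x∧d≤y))

  ∧-complementˡ : ∀ x → ¬ x ∧ x ≈ ⊥
  ∧-complementˡ x = ≤⊥⇒≈⊥ (transpose-∧ (x≤x∨y _ _))

  ∨-complementˡ : ∀ x → ¬ x ∨ x ≈ ⊤
  ∨-complementˡ x = ⊤≤⇒≈⊤ (transpose-⇨ (x∧y≤y _ _))

  -- Both inequalities are case distinctions: `y ≤ ¬ x` along the cover `¬ x`, `x`, and `¬ x ≤ y`
  -- along the cover `x`, `y`.
  complement-unique : ∀ {x y} → x ∨ y ≈ ⊤ → x ∧ y ≈ ⊥ → y ≈ ¬ x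
  complement-unique x∨y≈⊤ x∧y≈⊥ = antisym
    (∨-cases (∨-complementˡ _) (x∧y≤y _ _)
      (trans (reflexive (Eq.trans (∧-comm _ _) x∧y≈⊥)) (minimum _)))
    (∨-cases x∨y≈⊤ (trans (reflexive (∧-complementˡ _)) (minimum _)) (x∧y≤y _ _))

-- Valuations with prescribed values.

module _ {s ℓ m d : Level} (M : Nmatrix s ℓ m d) where
  open Nmatrix M

  -- Recursion on formulas, where nonemptiness supplies the value of each compound formula. Only the
  -- negation and the circle of the first variable are left free, to be chosen through `u`; this is
  -- what lets a schema speak about every element of a multioperation.
  valuation : (z w : Carrier) → (∀ ⋆ → Satisfiable (op₁ ⋆ z)) → Valuation M
  valuation z w u = record
    { value  = value
    ; isHom₁ = isHom₁
    ; isHom₂ = λ # α β → proj₂ (op₂-nonempty # _ _)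
    }
    where
    value : Formula → Carrier
    value (var zero)        = z
    value (var (suc _))     = w
    value (un ⋆ (var zero)) = proj₁ (u ⋆)
    value (un ⋆ α)          = proj₁ (op₁-nonempty ⋆ (value α))
    value (bin # α β)       = proj₁ (op₂-nonempty # (value α) (value β))

    isHom₁ : ∀ ⋆ α → value (un ⋆ α) ∈ op₁ ⋆ (value α)
    isHom₁ ⋆ (var zero)    = proj₂ (u ⋆)
    isHom₁ ⋆ (var (suc _)) = proj₂ (op₁-nonempty ⋆ _)
    isHom₁ ⋆ (bin _ _ _)   = proj₂ (op₁-nonempty ⋆ _)
    isHom₁ ⋆ (un _ _)      = proj₂ (op₁-nonempty ⋆ _)

  prescribe : ∀ ⋆ {z u} → u ∈ op₁ ⋆ z → ∀ ⋆′ → Satisfiable (op₁ ⋆′ z)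
  prescribe neg  u∈ neg  = _ , u∈
  prescribe neg  _  circ = op₁-nonempty circ _
  prescribe circ _  neg  = op₁-nonempty neg _
  prescribe circ u∈ circ = _ , u∈

private
  p q : Formula
  p = var 0
  q = var 1

-- Schemas as inequalities between coordinates.

module SwapStructure {a ℓ₁ ℓ₂ b m : Level} {𝓑 : TripleMultialgebra a ℓ₁ ℓ₂ b m}
                     (𝓑∈𝕂 : 𝓑 ∈ Classes.𝕂-CPL⁺ₑ a ℓ₁ ℓ₂ b m) where
  open Classes a ℓ₁ ℓ₂ b m
  open TripleMultialgebra 𝓑
  open BooleanAlgebraProperties 𝒜
  open 𝕂-CPL⁺ₑ 𝓑∈𝕂

  module FirstCoordinate (v : Valuation (𝓜 𝓑)) where
    open Valuation v

    ∣_∣₁ : Formula → BooleanAlgebra.Carrier 𝒜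
    ∣ α ∣₁ = fst (value α)

    un-fst : ∀ ⋆ α → ∣ un ⋆ α ∣₁ ≈ index ⋆ (proj₁ (value α))
    un-fst ⋆ α = op₁-fst ⋆ _ (isHom₁ ⋆ α)

    bin-fst : ∀ # α β → ∣ bin # α β ∣₁ ≈ ⟦ # ⟧ ∣ α ∣₁ ∣ β ∣₁
    bin-fst # α β = op₂-fst # _ _ (isHom₂ # α β)

    transpose-→ : ∀ {x} α β → x ∧ ∣ α ∣₁ ≤ ∣ β ∣₁ → x ≤ ∣ α →ᶠ β ∣₁
    transpose-→ α β x∧α≤β = trans (transpose-⇨ x∧α≤β) (reflexive (Eq.sym (bin-fst imp α β)))

    untranspose-→ : ∀ {x} α β → x ≤ ∣ α →ᶠ β ∣₁ → x ∧ ∣ α ∣₁ ≤ ∣ β ∣₁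
    untranspose-→ α β x≤α→β = transpose-∧ (trans x≤α→β (reflexive (bin-fst imp α β)))

    -- Residuation: `x ⇨ y` is the top element exactly when `x ≤ y`.
    →-designated : ∀ α β → ∣ α →ᶠ β ∣₁ ≈ ⊤ ⇔ ∣ α ∣₁ ≤ ∣ β ∣₁
    →-designated α β = mk⇔
      (λ e → trans (∧-greatest (maximum _) refl) (untranspose-→ α β (reflexive (Eq.sym e))))
      (λ α≤β → ⊤≤⇒≈⊤ (transpose-→ α β (trans (x∧y≤y _ _) α≤β)))

    ∧¬-fst : ∀ α → ∣ α ∧ᶠ ¬ᶠ α ∣₁ ≈ ∣ α ∣₁ ∧ snd (value α)
    ∧¬-fst α = Eq.trans (bin-fst and _ _) (∧-cong Eq.refl (un-fst neg α))

    ∨¬-fst : ∀ α → ∣ α ∨ᶠ ¬ᶠ α ∣₁ ≈ ∣ α ∣₁ ∨ snd (value α)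
    ∨¬-fst α = Eq.trans (bin-fst or _ _) (∨-cong Eq.refl (un-fst neg α))

  generic : (z w : Elt) → Valuation (𝓜 𝓑)
  generic z w = valuation (𝓜 𝓑) z w (λ ⋆ → op₁-nonempty ⋆ z)

  -- Gives `un ⋆ p` the value `u`. Then the first coordinate of `¬ᶠ un ⋆ p` is `snd u`, which is how
  -- (ci) and (cf) come to bound second coordinates.
  through : ∀ ⋆ {z u} → u ∈ op₁ ⋆ z → Valuation (𝓜 𝓑)
  through ⋆ {z} u∈ = valuation (𝓜 𝓑) z z (prescribe (𝓜 𝓑) ⋆ u∈)

  validates-Ax10 : Validating Ax10 𝓑 ⇔ (∀ z → fst z ∨ snd z ≈ ⊤)
  validates-Ax10 = mk⇔
    (λ ax z → let open FirstCoordinate (generic z z) in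
       Eq.trans (Eq.sym (∨¬-fst p)) (ax (inst p) (generic z z)))
    (λ { h (inst α) v → let open FirstCoordinate v in Eq.trans (∨¬-fst α) (h (Valuation.value v α)) })

  validates-bc1 : Validating bc1 𝓑 ⇔ (∀ z → fst z ∧ snd z ∧ thd z ≈ ⊥)
  validates-bc1 = mk⇔ necessary sufficient
    where
    necessary : Validating bc1 𝓑 → ∀ z → fst z ∧ snd z ∧ thd z ≈ ⊥
    necessary ax z = ≤⊥⇒≈⊥ (trans
      (∧-greatest (∧-greatest z₃≤∘p (x∧y≤x _ _)) z₂≤¬p)
      (trans (untranspose-→ (¬ᶠ p) q (untranspose-→ p (¬ᶠ p →ᶠ q)
               (to (→-designated (∘ᶠ p) (p →ᶠ (¬ᶠ p →ᶠ q))) (ax (inst p q) v))))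
             (reflexive (proj₂ zero∈π₁))))
      where
      -- The variable `q` in the place of `β` gets a value with first coordinate `⊥`, so the bound
      -- by `q` given by (bc1) becomes a bound by `⊥`.
      v = generic z (proj₁ zero∈π₁)
      open FirstCoordinate v
      z₃≤∘p : fst z ∧ snd z ∧ thd z ≤ ∣ ∘ᶠ p ∣₁
      z₃≤∘p = trans (x∧y≤y _ _) (trans (x∧y≤y _ _) (reflexive (Eq.sym (un-fst circ p))))
      z₂≤¬p : fst z ∧ snd z ∧ thd z ≤ ∣ ¬ᶠ p ∣₁
      z₂≤¬p = trans (x∧y≤y _ _) (trans (x∧y≤x _ _) (reflexive (Eq.sym (un-fst neg p))))

    sufficient : (∀ z → fst z ∧ snd z ∧ thd z ≈ ⊥) → Validating bc1 𝓑
    sufficient h (inst α β) v = from (→-designated (∘ᶠ α) (α →ᶠ (¬ᶠ α →ᶠ β)))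
      (transpose-→ α (¬ᶠ α →ᶠ β) (transpose-→ (¬ᶠ α) β (trans
      (∧-greatest (trans (x∧y≤x _ _) (x∧y≤y _ _))
        (∧-greatest (trans (x∧y≤y _ _) (reflexive (un-fst neg α)))
                    (trans (x∧y≤x _ _) (trans (x∧y≤x _ _) (reflexive (un-fst circ α))))))
      (trans (reflexive (h (Valuation.value v α))) (minimum _)))))
      where open FirstCoordinate v

  validates-ci : Validating ci 𝓑 ⇔ (∀ z → op₁ circ z ⊆ λ u → snd u ≤ fst z ∧ snd z)
  validates-ci = mk⇔
    (λ ax z {u} u∈ → let open FirstCoordinate (through circ u∈) in
       trans (reflexive (Eq.sym (un-fst neg (∘ᶠ p))))
         (trans (to (→-designated (¬ᶠ ∘ᶠ p) (p ∧ᶠ ¬ᶠ p)) (ax (inst p) (through circ u∈)))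
                (reflexive (∧¬-fst p))))
    (λ { h (inst α) v → let open FirstCoordinate v in
       from (→-designated (¬ᶠ ∘ᶠ α) (α ∧ᶠ ¬ᶠ α)) (trans (reflexive (un-fst neg (∘ᶠ α)))
         (trans (h (Valuation.value v α) (Valuation.isHom₁ v circ α))
                (reflexive (Eq.sym (∧¬-fst α))))) })

  validates-cf : Validating cf 𝓑 ⇔ (∀ z → op₁ neg z ⊆ λ u → snd u ≤ fst z)
  validates-cf = mk⇔
    (λ ax z {u} u∈ → let open FirstCoordinate (through neg u∈) in
       trans (reflexive (Eq.sym (un-fst neg (¬ᶠ p))))
         (to (→-designated (¬ᶠ ¬ᶠ p) p) (ax (inst p) (through neg u∈))))
    (λ { h (inst α) v → let open FirstCoordinate v in
       from (→-designated (¬ᶠ ¬ᶠ α) α) (trans (reflexive (un-fst neg (¬ᶠ α)))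
         (h (Valuation.value v α) (Valuation.isHom₁ v neg α))) })

-- Equalities of classes.

module _ {a ℓ₁ ℓ₂ b m : Level} where
  open Classes a ℓ₁ ℓ₂ b m

  mbC≐ : 𝕂-mbC ≐ 𝕂-CPL⁺ₑ ∩ Validating Ax10 ∩ Validating bc1
  mbC≐ =
    (λ (K , B⊆) → let open SwapStructure K in
       K , from validates-Ax10 (λ z → proj₁ (B⊆ (proj₂ z)))
         , from validates-bc1  (λ z → proj₂ (B⊆ (proj₂ z)))) ,
    (λ (K , ax10 , bc) → let open SwapStructure K in
       K , λ z∈B → to validates-Ax10 ax10 (_ , z∈B) , to validates-bc1 bc (_ , z∈B))

  mbCciw⊆mbC : 𝕂-mbCciw ⊆ 𝕂-mbC
  mbCciw⊆mbC {𝓑} (K , B⊆) = K , λ z∈B → let z₁∨z₂≈⊤ , z₃≈ = B⊆ z∈B in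
    z₁∨z₂≈⊤ ,
    Eq.trans (Eq.sym (∧-assoc _ _ _))
      (Eq.trans (∧-comm _ _) (Eq.trans (∧-cong z₃≈ Eq.refl) (∧-complementˡ _)))
    where
    open TripleMultialgebra 𝓑
    open BooleanAlgebraProperties 𝒜

  mbCci⊆ci : 𝕂-mbCci ⊆ Validating ci
  mbCci⊆ci {𝓑} ((K , _) , circ≐) = from validates-ci
    (λ z u∈ → let _ , u₂≈ , _ = proj₁ (circ≐ z) u∈ in reflexive u₂≈)
    where
    open TripleMultialgebra 𝓑
    open SwapStructure K

  mbC∩ci⊆mbCciw : 𝕂-mbC ∩ Validating ci ⊆ 𝕂-mbCciw
  mbC∩ci⊆mbCciw {𝓑} ((K , B⊆) , ax) = K , λ z∈B → proj₁ (B⊆ z∈B) , thd≈ (_ , z∈B)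
    where
    open TripleMultialgebra 𝓑
    open BooleanAlgebraProperties 𝒜
    open SwapStructure K
    open 𝕂-CPL⁺ₑ K
    thd≈ : ∀ z → thd z ≈ ¬ (fst z ∧ snd z)
    -- A single `u` in `∘z` suffices: `u₁ = z₃` and `u₂ ≤ z₁ ∧ z₂` turn `u₁ ∨ u₂ = 1` into the
    -- covering half of complementarity, and the mbC condition on `z` is the disjointness half.
    thd≈ z with u , u∈ ← op₁-nonempty circ z = complement-unique
      (⊤≤⇒≈⊤ (trans (reflexive (Eq.sym (proj₁ (B⊆ (proj₂ u)))))
        (∨-least (trans (reflexive (op₁-fst circ z u∈)) (y≤x∨y _ _))
                 (trans (to validates-ci ax z u∈) (x≤x∨y _ _)))))
      (Eq.trans (∧-assoc _ _ _) (proj₂ (B⊆ (proj₂ z))))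

  mbCciw∩ci⊆mbCci : 𝕂-mbCciw ∩ Validating ci ⊆ 𝕂-mbCci
  mbCciw∩ci⊆mbCci {𝓑} ((K , B⊆) , ax) = (K , B⊆) , λ z →
    circ-value ,
    -- The converse inclusion: `∘z` has some element `u′`, which must be the prescribed triple, and
    -- membership is invariant under equality of triples.
    λ u≈ → let u′ , u′∈ = op₁-nonempty circ z in
      op₁-resp circ ≈³-refl (≈³-trans (circ-value u′∈) (≈³-sym u≈)) u′∈
    where
    open TripleMultialgebra 𝓑
    open BooleanAlgebraProperties 𝒜
    open SwapStructure K
    open 𝕂-CPL⁺ₑ K
    open Setoid A³ using () renaming (refl to ≈³-refl; sym to ≈³-sym; trans to ≈³-trans)
    circ-value : ∀ {z u} → u ∈ op₁ circ z → proj₁ u ≈³ (¬ (fst z ∧ snd z) , fst z ∧ snd z , ⊤)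
    circ-value {z} {u} u∈ = u₁≈ , u₂≈ , u₃≈
      where
      u₁≈ = Eq.trans (op₁-fst circ z u∈) (proj₂ (B⊆ (proj₂ z)))
      ¬x∧x≈⊥ = ∧-complementˡ (fst z ∧ snd z)
      -- For `z₁ ∧ z₂ ≤ u₂`, split along `u₁ ∨ u₂ = 1`: the part below `u₁ = ¬ (z₁ ∧ z₂)` vanishes.
      u₂≈ = antisym (to validates-ci ax z u∈)
        (∨-cases (proj₁ (B⊆ (proj₂ u)))
          (trans (reflexive (Eq.trans (∧-cong Eq.refl u₁≈) (Eq.trans (∧-comm _ _) ¬x∧x≈⊥)))
                 (minimum _))
          (x∧y≤y _ _))
      u₁∧u₂≈⊥ = Eq.trans (∧-cong u₁≈ u₂≈) ¬x∧x≈⊥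
      -- Since `u₁ ∧ u₂ = 0`, its complement `u₃` is the top element.
      u₃≈ = Eq.trans (proj₂ (B⊆ (proj₂ u)))
        (⊤≤⇒≈⊤ (trans (reflexive (Eq.sym (∨-complementˡ (fst u ∧ snd u))))
          (∨-least refl (trans (reflexive u₁∧u₂≈⊥) (minimum _)))))

  mbCci≐mbCciw∩ci : 𝕂-mbCci ≐ 𝕂-mbCciw ∩ Validating ci
  mbCci≐mbCciw∩ci = (λ K → proj₁ K , mbCci⊆ci K) , mbCciw∩ci⊆mbCci

  mbCci≐mbC∩ci : 𝕂-mbCci ≐ 𝕂-mbC ∩ Validating ci
  mbCci≐mbC∩ci =
    (λ K → mbCciw⊆mbC (proj₁ K) , mbCci⊆ci K) ,
    (λ K → mbCciw∩ci⊆mbCci (mbC∩ci⊆mbCciw K , proj₂ K))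

  mbCci≐CPL⁺ₑ : 𝕂-mbCci ≐ 𝕂-CPL⁺ₑ ∩ Validating Ax10 ∩ Validating bc1 ∩ Validating ci
  mbCci≐CPL⁺ₑ =
    (λ K → let K′ , c = proj₁ mbCci≐mbC∩ci K
               K″ , ax10 , bc = proj₁ mbC≐ K′ in K″ , ax10 , bc , c) ,
    (λ (K , ax10 , bc , c) → proj₂ mbCci≐mbC∩ci (proj₂ mbC≐ (K , ax10 , bc) , c))

  -- The equation `u₁ = z₂` holds in every swap structure, so only `u₂ ≤ z₁` remains to be matched
  -- with (cf).
  Ci≐mbCci∩cf : 𝕂-Ci ≐ 𝕂-mbCci ∩ Validating cf
  Ci≐mbCci∩cf =
    (λ (K , neg⊆) → let open SwapStructure (proj₁ (proj₁ K)) in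
       K , from validates-cf (λ z u∈ → proj₂ (neg⊆ z u∈))) ,
    (λ (K , c) → let open SwapStructure (proj₁ (proj₁ K)) in
       K , λ z u∈ → 𝕂-CPL⁺ₑ.op₁-fst (proj₁ (proj₁ K)) neg z u∈ , to validates-cf c z u∈)

proposition8p15 : (a ℓ₁ ℓ₂ b m : Level) → let open Classes a ℓ₁ ℓ₂ b m in
    ( (𝕂-mbCci ≐ 𝕂-mbCciw ∩ Validating ci)
    × (𝕂-mbCci ≐ 𝕂-mbC ∩ Validating ci)
    × (𝕂-mbCci ≐ 𝕂-CPL⁺ₑ ∩ Validating Ax10 ∩ Validating bc1 ∩ Validating ci) )
    ×
    ( (𝕂-Ci ≐ 𝕂-mbCci ∩ Validating cf)
    × (𝕂-Ci ≐ 𝕂-mbCciw ∩ Validating ci ∩ Validating cf)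
    × (𝕂-Ci ≐ 𝕂-mbC ∩ Validating ci ∩ Validating cf)
    × (𝕂-Ci ≐ 𝕂-CPL⁺ₑ ∩ Validating Ax10 ∩ Validating bc1 ∩ Validating ci ∩ Validating cf) )
proposition8p15 a ℓ₁ ℓ₂ b m =
  (mbCci≐mbCciw∩ci , mbCci≐mbC∩ci , mbCci≐CPL⁺ₑ) ,
  ( Ci≐mbCci∩cf
  , ( (λ K → let K′ , f = proj₁ Ci≐mbCci∩cf K ; K″ , c = proj₁ mbCci≐mbCciw∩ci K′ in K″ , c , f)
    , (λ (K , c , f) → proj₂ Ci≐mbCci∩cf (proj₂ mbCci≐mbCciw∩ci (K , c) , f)) )
  , ( (λ K → let K′ , f = proj₁ Ci≐mbCci∩cf K ; K″ , c = proj₁ mbCci≐mbC∩ci K′ in K″ , c , f)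
    , (λ (K , c , f) → proj₂ Ci≐mbCci∩cf (proj₂ mbCci≐mbC∩ci (K , c) , f)) )
  , ( (λ K → let K′ , f = proj₁ Ci≐mbCci∩cf K
                 K″ , ax10 , bc , c = proj₁ mbCci≐CPL⁺ₑ K′ in K″ , ax10 , bc , c , f)
    , (λ (K , ax10 , bc , c , f) →
         proj₂ Ci≐mbCci∩cf (proj₂ mbCci≐CPL⁺ₑ (K , ax10 , bc , c) , f)) ) )
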